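{- If $\mu$ is a super-strict partition, then the generating function $\sum_{n\ge1}|\mathrm{Av}_n(\mu)|z^n$ is a rational function of $z$.
   Context: A partition is a weakly decreasing sequence of nonnegative integers with finitely many nonzero parts, identified with its Ferrers board. $\alpha$ contains $\mu$ if one can delete some rows and some columns of the Ferrers board of $\alpha$ so that after top/left-justifying the remaining boxes one obtains $\mu$; otherwise $\alpha$ avoids $\mu$. $\mathrm{Av}_n(\mu)$ is the set of partitions of weight $n$ avoiding $\mu$. A partition is super-strict if any two of its positive parts differ by at least $2$. -}

module Defs where

open import Data.Bool using (true; false)
open import Data.Fin using (toℕ)
open import Data.Fin.Subset using (Subset; ∣_∣; _∩_)
open import Data.Fin.Subset.Properties using (anySubset?)
open import Data.Integer as ℤ using (ℤ; +_; 0ℤ)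
open import Data.List using (List; []; _∷_; length; map; filter; foldr; upTo; cartesianProductWith)
open import Data.List.Membership.Propositional using (_∈_)
open import Data.List.Membership.Propositional.Properties
  using (∈-cartesianProductWith⁺; ∈-map⁺; ∈-upTo⁺; ∈-filter⁺; ∈-filter⁻)
open import Data.List.Properties using (≡-dec)
open import Data.List.Relation.Unary.All as All using (All; []; _∷_)
import Data.List.Relation.Unary.All.Properties as All
open import Data.List.Relation.Unary.AllPairs using (AllPairs; []; _∷_)
open import Data.List.Relation.Unary.Any using (here; there)
open import Data.List.Relation.Unary.Linked using (Linked; linked?)
open import Data.List.Relation.Unary.Unique.Propositional using (Unique)
import Data.List.Relation.Unary.Unique.Propositional.Properties as Unique
open import Data.Nat using (ℕ; zero; suc; _∸_; _⊔_; _≤_; _<_; _≥_; _<ᵇ_; s≤s; ∣_-_∣)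
open import Data.Nat.ListAction using (sum)
open import Data.Nat.Properties
  using (_≟_; _<?_; _≥?_; suc-injective; ≤-refl; ≤-trans; m≤m+n; m≤n+m)
open import Data.Product using (∃-syntax; _×_; _,_; proj₂)
open import Data.Vec using ([]; _∷_; tabulate)
open import Function using (_⇔_; mk⇔)
open import Relation.Binary.PropositionalEquality using (_≡_; _≢_; refl; setoid)
open import Relation.Nullary using (¬_; Dec; ¬?; _×-dec_)
open import Relation.Nullary.Decidable using (map′)

-- A partition is represented by the list of its positive parts.
record IsPartition (α : List ℕ) : Set where
  constructor isPartition
  field
    decreasing : Linked _≥_ α
    positive   : All (0 <_) α

SuperStrict : List ℕ → Set
SuperStrict = AllPairs (λ a b → 2 ≤ ∣ a - b ∣)

width : List ℕ → ℕ
width = foldr _⊔_ 0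

-- The columns (out of w) occupied by a left-justified row of a boxes.
row : (w a : ℕ) → Subset w
row w a = tabulate (λ j → toℕ j <ᵇ a)

select : ∀ {A : Set} (xs : List A) → Subset (length xs) → List A
select []       []          = []
select (x ∷ xs) (true  ∷ R) = x ∷ select xs R
select (x ∷ xs) (false ∷ R) = select xs R

-- The partition left after keeping only the rows in R and the columns in C.
-- Left-justifying a row leaves only its number of surviving boxes. The
-- surviving boxes of a higher row include those of every lower one, up to
-- column, so top-justifying amounts to discarding the emptied rows.
restrict : (α : List ℕ) → Subset (length α) → Subset (width α) → List ℕ
restrict α R C = filter (0 <?_) (map (λ a → ∣ row (width α) a ∩ C ∣) (select α R))

_Contains_ : List ℕ → List ℕ → Set
α Contains μ = ∃[ R ] ∃[ C ] restrict α R C ≡ μ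

_Avoids_ : List ℕ → List ℕ → Set
α Avoids μ = ¬ (α Contains μ)

isPartition? : ∀ α → Dec (IsPartition α)
isPartition? α = map′ (λ (d , p) → isPartition d p)
                      (λ (isPartition d p) → d , p)
                      (linked? _≥?_ α ×-dec All.all? (0 <?_) α)

contains? : ∀ α μ → Dec (α Contains μ)
contains? α μ = anySubset? λ R → anySubset? λ C → ≡-dec _≟_ (restrict α R C) μ

avoids? : ∀ α μ → Dec (α Avoids μ)
avoids? α μ = ¬? (contains? α μ)

InAv : List ℕ → ℕ → List ℕ → Set
InAv μ n α = IsPartition α × sum α ≡ n × α Avoids μ

inAv? : ∀ μ n α → Dec (InAv μ n α)
inAv? μ n α = isPartition? α ×-dec (sum α ≟ n) ×-dec avoids? α μ

-- All lists of length at most k with entries in 1, …, n.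
lists : (n k : ℕ) → List (List ℕ)
lists n zero    = [] ∷ []
lists n (suc k) = [] ∷ cartesianProductWith _∷_ (map suc (upTo n)) (lists n k)

Av : List ℕ → ℕ → List (List ℕ)
Av μ n = filter (inAv? μ n) (lists n n)

-- Av μ n lists every partition of n avoiding μ exactly once.

private
  lists-complete : ∀ {n} k {α} → All (0 <_) α → sum α ≤ n → sum α ≤ k → α ∈ lists n k
  lists-complete zero    []        _  _  = here refl
  lists-complete zero    (s≤s _ ∷ _) _ ()
  lists-complete (suc k) []        _  _  = here refl
  lists-complete {n} (suc k) {suc a ∷ α} (_ ∷ ps) ≤n (s≤s ≤k) = there
    (∈-cartesianProductWith⁺ _∷_
      (∈-map⁺ suc (∈-upTo⁺ (≤-trans (m≤m+n (suc a) (sum α)) ≤n)))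
      (lists-complete k ps (≤-trans (m≤n+m (sum α) (suc a)) ≤n)
                           (≤-trans (m≤n+m (sum α) a) ≤k)))

  lists-unique : ∀ n k → Unique (lists n k)
  lists-unique n zero    = [] ∷ []
  lists-unique n (suc k) =
    All.cartesianProductWith⁺ (setoid ℕ) (setoid (List ℕ)) _∷_ (map suc (upTo n)) (lists n k)
      (λ _ _ ())
    ∷ Unique.cartesianProductWith⁺ _∷_ (λ { refl → refl , refl })
        (Unique.map⁺ suc-injective (Unique.upTo⁺ n)) (lists-unique n k)

∈-Av : ∀ μ n α → α ∈ Av μ n ⇔ InAv μ n α
∈-Av μ n α = mk⇔
  (λ α∈ → proj₂ (∈-filter⁻ (inAv? μ n) {xs = lists n n} α∈))
  (λ { p@(isp , refl , _) →
       ∈-filter⁺ (inAv? μ n) (lists-complete n (IsPartition.positive isp) ≤-refl ≤-refl) p })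

Av-unique : ∀ μ n → Unique (Av μ n)
Av-unique μ n = Unique.filter⁺ (inAv? μ n) (lists-unique n n)

PowerSeries : Set
PowerSeries = ℕ → ℤ

-- A polynomial is the list of its coefficients, constant term first
-- (trailing zeros allowed).
Polynomial : Set
Polynomial = List ℤ

⟦_⟧ : Polynomial → PowerSeries
⟦ []    ⟧ n       = 0ℤ
⟦ c ∷ p ⟧ zero    = c
⟦ c ∷ p ⟧ (suc n) = ⟦ p ⟧ n

infixl 7 _⊛_

_⊛_ : PowerSeries → PowerSeries → PowerSeries
(f ⊛ g) n = foldr ℤ._+_ 0ℤ (map (λ i → f i ℤ.* g (n ∸ i)) (upTo (suc n)))

-- f = P / Q with Q a nonzero polynomial. Integer coefficients suffice, since
-- the field of fractions of ℤ[z] is ℚ(z).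
IsRational : PowerSeries → Set
IsRational f = ∃[ P ] ∃[ Q ] (∃[ i ] ⟦ Q ⟧ i ≢ 0ℤ) × (∀ n → (⟦ Q ⟧ ⊛ f) n ≡ ⟦ P ⟧ n)

-- ∑_{n ≥ 1} |Av_n(μ)| zⁿ
avoidanceSeries : List ℕ → PowerSeries
avoidanceSeries μ zero      = 0ℤ
avoidanceSeries μ n@(suc _) = + length (Av μ n)

{-# OPTIONS --safe #-}
-- A partition α contains a partition μ with distinct parts iff α has parts
-- x₁, …, xₖ whose successive differences, and whose smallest member, are at
-- least those of μ. Looking for these greedily from the smallest part of α
-- upwards shows that the parts of an avoiding α lie in fewer than k windows
-- {b, …, b + d − 1}, with b a part of α and d a gap of μ, besides the parts
-- smaller than the last part of μ. With Pₘ(b) = 1 / (1 − zᵇ)⋯(1 − zᵇ⁺ᵐ⁻¹), a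
-- window contributes zᵇ P_d(b), to be multiplied by the series for the parts
-- ≥ b + d and summed over b. If the latter series is a combination of Pₘ(b + d)
-- then so is the sum, because zᵇ Pₘ(b) telescopes for m ≥ 2:
--   (1 − zᵐ⁻¹) zᵇ Pₘ(b) = Pₘ₋₁(b) − Pₘ₋₁(b + 1).
-- This is where d ≥ 2 enters: Σ zᵇ / (1 − zᵇ) is not rational.
module Submission where

open import Defs
open import Data.Nat using (ℕ)
open import Data.List using (List)

module Series where

  open import Data.Integer using (ℤ; 0ℤ; 1ℤ; _+_; _-_; -_; _*_)
  open import Data.Integer.Properties using (+-identityʳ; +-identityˡ; +-inverseʳ)
  open import Data.Integer.Tactic.RingSolver using (solve-∀)
  open import Data.List using (List; []; _∷_; foldr; applyUpTo)
  open import Data.List.Properties using (map-applyUpTo)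
  open import Data.List.Relation.Unary.All using (All; []; _∷_)
  open import Data.Nat as ℕ using (ℕ; zero; suc; _∸_; _≤_; _<_; z≤n; s≤s)
  import Data.Nat.Properties as ℕ
  open import Data.Product using (∃-syntax; _,_)
  open import Function using (_∘_; id)
  open import Relation.Binary.PropositionalEquality

  -- Power series: shifts and multiplication by 1 - zᵃ⁺¹.

  infixl 6 _⊕_
  infix 4 _≗₂_

  shift : ℕ → PowerSeries → PowerSeries
  shift zero    f n       = f n
  shift (suc k) f zero    = 0ℤ
  shift (suc k) f (suc n) = shift k f n

  _⊕_ : PowerSeries → PowerSeries → PowerSeries
  (f ⊕ g) n = f n + g n

  ⊖_ : PowerSeries → PowerSeries
  (⊖ f) n = - f n

  one : PowerSeries
  one zero    = 1ℤ
  one (suc _) = 0ℤ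

  -- Multiplication by 1 − zᵃ⁺¹, invertible for every a.
  D : ℕ → PowerSeries → PowerSeries
  D a f n = f n - shift (suc a) f n

  shift-local : ∀ k {f g n} → (∀ m → m ≤ n → f m ≡ g m) → shift k f n ≡ shift k g n
  shift-local zero            eq = eq _ ℕ.≤-refl
  shift-local (suc k) {n = zero}  eq = refl
  shift-local (suc k) {n = suc n} eq = shift-local k λ m m≤n → eq m (ℕ.m≤n⇒m≤1+n m≤n)

  -- Degree n of a proper shift sees only lower degrees, which makes recursion through
  -- `shift (suc a)` well founded.
  shift-suc-local : ∀ k {f g n} → (∀ m → m < n → f m ≡ g m) → shift (suc k) f n ≡ shift (suc k) g n
  shift-suc-local k {n = zero}  eq = refl
  shift-suc-local k {n = suc n} eq = shift-local k λ m m≤n → eq m (s≤s m≤n)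

  shift-cong : ∀ k {f g} → f ≗ g → shift k f ≗ shift k g
  shift-cong k eq n = shift-local k λ m _ → eq m

  shift-⊕ : ∀ k f g → shift k (f ⊕ g) ≗ shift k f ⊕ shift k g
  shift-⊕ zero    f g n       = refl
  shift-⊕ (suc k) f g zero    = refl
  shift-⊕ (suc k) f g (suc n) = shift-⊕ k f g n

  shift-⊖ : ∀ k f → shift k (⊖ f) ≗ ⊖ shift k f
  shift-⊖ zero    f n       = refl
  shift-⊖ (suc k) f zero    = refl
  shift-⊖ (suc k) f (suc n) = shift-⊖ k f n

  shift-shift : ∀ j k f → shift j (shift k f) ≗ shift (j ℕ.+ k) f
  shift-shift zero    k f n       = refl
  shift-shift (suc j) k f zero    = refl
  shift-shift (suc j) k f (suc n) = shift-shift j k f n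

  shift-comm : ∀ j k f → shift j (shift k f) ≗ shift k (shift j f)
  shift-comm j k f n = begin
    shift j (shift k f) n   ≡⟨ shift-shift j k f n ⟩
    shift (j ℕ.+ k) f n     ≡⟨ cong (λ i → shift i f n) (ℕ.+-comm j k) ⟩
    shift (k ℕ.+ j) f n     ≡⟨ shift-shift k j f n ⟨
    shift k (shift j f) n   ∎
    where open ≡-Reasoning

  shift-small : ∀ k f {n} → n < k → shift k f n ≡ 0ℤ
  shift-small (suc k) f {zero}  _         = refl
  shift-small (suc k) f {suc n} (s≤s n<k) = shift-small k f n<k

  shift-+ : ∀ k f m → shift k f (k ℕ.+ m) ≡ f m
  shift-+ zero    f m = refl
  shift-+ (suc k) f m = shift-+ k f m

  D-cong : ∀ a {f g} → f ≗ g → D a f ≗ D a g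
  D-cong a eq n = cong₂ _-_ (eq n) (shift-cong (suc a) eq n)

  D-⊕ : ∀ a f g → D a (f ⊕ g) ≗ D a f ⊕ D a g
  D-⊕ a f g n = trans (cong (λ s → f n + g n - s) (shift-⊕ (suc a) f g n)) (lem (f n) (g n) _ _)
    where
    lem : ∀ x y u v → x + y - (u + v) ≡ (x - u) + (y - v)
    lem = solve-∀

  D-⊖ : ∀ a f → D a (⊖ f) ≗ ⊖ D a f
  D-⊖ a f n = trans (cong (λ s → - f n - s) (shift-⊖ (suc a) f n)) (lem (f n) _)
    where
    lem : ∀ x u → - x - (- u) ≡ - (x - u)
    lem = solve-∀

  shift-D : ∀ k a f → shift k (D a f) ≗ D a (shift k f)
  shift-D k a f n = begin
    shift k (D a f) n
      ≡⟨ shift-⊕ k f (⊖ shift (suc a) f) n ⟩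
    shift k f n + shift k (⊖ shift (suc a) f) n
      ≡⟨ cong (shift k f n +_) (shift-⊖ k (shift (suc a) f) n) ⟩
    shift k f n - shift k (shift (suc a) f) n
      ≡⟨ cong (λ s → shift k f n - s) (shift-comm k (suc a) f n) ⟩
    D a (shift k f) n ∎
    where open ≡-Reasoning

  D-comm : ∀ a b f → D a (D b f) ≗ D b (D a f)
  D-comm a b f n = begin
    D b f n - shift (suc a) (D b f) n
      ≡⟨ cong (λ s → D b f n - s) (shift-D (suc a) b f n) ⟩
    D b f n - D b (shift (suc a) f) n
      ≡⟨ cong (D b f n +_) (D-⊖ b (shift (suc a) f) n) ⟨
    D b f n + D b (⊖ shift (suc a) f) n
      ≡⟨ D-⊕ b f (⊖ shift (suc a) f) n ⟨
    D b (D a f) n ∎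
    where open ≡-Reasoning

  -- Strong induction on the degree: a coefficient of f is that of `D a f` plus either 0 or a
  -- coefficient of f of lower degree.
  D-injective : ∀ a {f g} → D a f ≗ D a g → f ≗ g
  D-injective a {f} {g} eq n = below n n ℕ.≤-refl
    where
    open ≡-Reasoning
    cancel : ∀ x y → x ≡ (x - y) + y
    cancel = solve-∀
    below : ∀ k m → m ≤ k → f m ≡ g m
    step : ∀ k m → m ≤ k → shift (suc a) f m ≡ shift (suc a) g m
    below k m m≤k = begin
      f m                           ≡⟨ cancel (f m) _ ⟩
      D a f m + shift (suc a) f m   ≡⟨ cong₂ _+_ (eq m) (step k m m≤k) ⟩
      D a g m + shift (suc a) g m   ≡⟨ cancel (g m) _ ⟨
      g m                           ∎
    step zero    zero _   = refl
    step (suc k) m    m≤k = shift-suc-local a λ i i<m →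
      below k i (ℕ.≤-pred (ℕ.≤-trans i<m m≤k))

  -- Division by 1 - zᵃ⁺¹.

  -- The first k terms of f / (1 − zᵃ⁺¹) = f + zᵃ⁺¹ f + ⋯; coefficient n only
  -- needs k > n.
  geometric : ℕ → PowerSeries → ℕ → PowerSeries
  geometric a f zero    n = 0ℤ
  geometric a f (suc k) n = f n + shift (suc a) (geometric a f k) n

  inv : ℕ → PowerSeries → PowerSeries
  inv a f n = geometric a f (suc n) n

  geometric-stable : ∀ a f k l {n} → n < k → n < l → geometric a f k n ≡ geometric a f l n
  geometric-stable a f (suc k) (suc l) (s≤s n≤k) (s≤s n≤l) =
    cong (f _ +_) (shift-suc-local a λ m m<n →
      geometric-stable a f k l (ℕ.<-≤-trans m<n n≤k) (ℕ.<-≤-trans m<n n≤l))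

  D-inv : ∀ a f → D a (inv a f) ≗ f
  D-inv a f n = trans
    (cong (λ s → f n + s - shift (suc a) (inv a f) n)
      -- `inv` truncates at a point that varies with the degree; in degree m < n, the truncations to
      -- n and to m + 1 terms agree.
      (shift-suc-local a λ m m<n → geometric-stable a f n (suc m) m<n ℕ.≤-refl))
    (lem (f n) _)
    where
    lem : ∀ x y → x + y - y ≡ x
    lem = solve-∀

  -- As `D a` is injective, an identity for `inv a` need only be checked after multiplying by 1 -
  -- zᵃ⁺¹; the linearity and commutation laws come from this.
  inv-unique : ∀ a {f g} → D a g ≗ f → g ≗ inv a f
  inv-unique a {f} eq = D-injective a λ n → trans (eq n) (sym (D-inv a f n))

  inv-rec : ∀ a f n → inv a f n ≡ f n + shift (suc a) (inv a f) n
  inv-rec a f n = trans (cancel (inv a f n) t) (cong (_+ t) (D-inv a f n))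
    where
    t = shift (suc a) (inv a f) n
    cancel : ∀ x y → x ≡ (x - y) + y
    cancel = solve-∀

  inv-cong : ∀ a {f g} → f ≗ g → inv a f ≗ inv a g
  inv-cong a {f} eq = inv-unique a λ n → trans (D-inv a f n) (eq n)

  inv-⊕ : ∀ a f g → inv a f ⊕ inv a g ≗ inv a (f ⊕ g)
  inv-⊕ a f g = inv-unique a λ n →
    trans (D-⊕ a (inv a f) (inv a g) n) (cong₂ _+_ (D-inv a f n) (D-inv a g n))

  inv-⊖ : ∀ a f → ⊖ inv a f ≗ inv a (⊖ f)
  inv-⊖ a f = inv-unique a λ n → trans (D-⊖ a (inv a f) n) (cong -_ (D-inv a f n))

  D-inv-comm : ∀ a b f → D b (inv a f) ≗ inv a (D b f)
  D-inv-comm a b f = inv-unique a λ n →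
    trans (D-comm a b (inv a f) n) (D-cong b (D-inv a f) n)

  -- Families indexed by the least part, and windows of factors.

  -- The index b stands for the part size b + 1.
  Family : Set
  Family = ℕ → PowerSeries

  _≗₂_ : Family → Family → Set
  F ≗₂ G = ∀ b → F b ≗ G b

  -- W e F b = F (b + e) / (1 − zᵇ⁺¹)⋯(1 − zᵇ⁺ᵉ).
  W : ℕ → Family → Family
  W zero    F b = F b
  W (suc e) F b = inv b (W e F (suc b))

  W-cong : ∀ e {F G} → F ≗₂ G → W e F ≗₂ W e G
  W-cong zero    eq b = eq b
  W-cong (suc e) eq b = inv-cong b (W-cong e eq (suc b))

  W-⊕ : ∀ e F G → (λ b → W e F b ⊕ W e G b) ≗₂ W e (λ b → F b ⊕ G b)
  W-⊕ zero    F G b n = refl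
  W-⊕ (suc e) F G b n = trans (inv-⊕ b (W e F (suc b)) (W e G (suc b)) n) (inv-cong b (W-⊕ e F G (suc b)) n)

  W-⊖ : ∀ e F → (λ b → ⊖ W e F b) ≗₂ W e (λ b → ⊖ F b)
  W-⊖ zero    F b n = refl
  W-⊖ (suc e) F b n = trans (inv-⊖ b (W e F (suc b)) n) (inv-cong b (W-⊖ e F (suc b)) n)

  D-W : ∀ e a F → (λ b → D a (W e F b)) ≗₂ W e (λ b → D a (F b))
  D-W zero    a F b n = refl
  D-W (suc e) a F b n = trans (D-inv-comm b a (W e F (suc b)) n) (inv-cong b (D-W e a F (suc b)) n)

  W-W : ∀ d e F → W d (W e F) ≗₂ W (d ℕ.+ e) F
  W-W zero    e F b n = refl
  W-W (suc d) e F b n = inv-cong b (W-W d e F (suc b)) n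

  inv-small : ∀ a f {n} → n ≤ a → inv a f n ≡ f n
  inv-small a f n≤a = trans (inv-rec a f _) (trans
    (cong (f _ +_) (shift-small (suc a) (inv a f) (s≤s n≤a))) (+-identityʳ (f _)))

  -- Each factor 1 - zᶜ divided out has c > b, so coefficients up to degree b are unaffected.
  W-small : ∀ e F → (∀ b {n} → n ≤ b → F b n ≡ one n) → ∀ b {n} → n ≤ b → W e F b n ≡ one n
  W-small zero    F eq b n≤b = eq b n≤b
  W-small (suc e) F eq b n≤b =
    trans (inv-small b (W e F (suc b)) n≤b) (W-small e F eq (suc b) (ℕ.m≤n⇒m≤1+n n≤b))

  P : ℕ → Family
  P m = W m (λ _ → one)

  P-small : ∀ m b {n} → n ≤ b → P m b n ≡ one n
  P-small m = W-small m (λ _ → one) λ _ _ → refl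

  -- 1 - zᵇ⁺ᵐ⁺¹ is the innermost factor of `P (suc m) b`; `D` commutes past the outer inverses and
  -- cancels it.
  D-P-last : ∀ m b → D (b ℕ.+ m) (P (suc m) b) ≗ P m b
  D-P-last zero    b n rewrite ℕ.+-identityʳ b = D-inv b one n
  D-P-last (suc m) b n rewrite ℕ.+-suc b m = trans
    (D-inv-comm b (suc (b ℕ.+ m)) (P (suc m) (suc b)) n)
    (inv-cong b (D-P-last m (suc b)) n)

  -- Both sides are P (2 + a) b times (1 − zᵇ⁺ᵃ⁺²) − (1 − zᵇ⁺¹).
  P-telescope : ∀ a b → D a (shift (suc b) (P (2 ℕ.+ a) b)) ≗ (P (suc a) b ⊕ (⊖ P (suc a) (suc b)))
  P-telescope a b n = begin
    s - shift (suc a) (shift (suc b) p) n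
      ≡⟨ lem (p n) s _ ⟩
    (p n - shift (suc a) (shift (suc b) p) n) - (p n - s)
      ≡⟨ cong₂ (λ x y → p n - x - y) (shift-shift (suc a) (suc b) p n) (D-inv b (P (suc a) (suc b)) n) ⟩
    (p n - shift (suc (a ℕ.+ suc b)) p n) - P (suc a) (suc b) n
      ≡⟨ cong (λ i → p n - shift (suc i) p n - P (suc a) (suc b) n) i≡ ⟩
    D (b ℕ.+ suc a) p n - P (suc a) (suc b) n
      ≡⟨ cong (λ x → x - P (suc a) (suc b) n) (D-P-last (suc a) b n) ⟩
    P (suc a) b n - P (suc a) (suc b) n ∎
    where
    open ≡-Reasoning
    p = P (2 ℕ.+ a) b
    s = shift (suc b) p n
    lem : ∀ x s t → s - t ≡ (x - t) - (x - s)
    lem = solve-∀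
    i≡ : a ℕ.+ suc b ≡ b ℕ.+ suc a
    i≡ = trans (ℕ.+-suc a b) (trans (cong suc (ℕ.+-comm a b)) (sym (ℕ.+-suc b a)))

  -- Infinite sums over the least part.

  -- H b = Σ_{c ≥ b} zᶜ⁺¹ F c.
  record IsSum (F H : Family) : Set where
    field
      rec    : ∀ b n → H b n ≡ H (suc b) n + shift (suc b) (F b) n
      vanish : ∀ b {n} → n ≤ b → H b n ≡ 0ℤ
  open IsSum

  -- Unfolding `rec` raises b until n ≤ b, where both candidates vanish; k bounds the unfoldings
  -- still needed. An infinite sum is thus identified without limits.
  IsSum-unique : ∀ {F H H′} → IsSum F H → IsSum F H′ → H ≗₂ H′
  IsSum-unique {F} {H} {H′} s s′ b n = agree n b (ℕ.m≤n+m n b)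
    where
    agree : ∀ k b {n} → n ≤ b ℕ.+ k → H b n ≡ H′ b n
    agree zero    b n≤ = trans (vanish s b n≤b) (sym (vanish s′ b n≤b))
      where n≤b = subst (_ ≤_) (ℕ.+-identityʳ b) n≤
    agree (suc k) b {n} n≤ = begin
      H b n         ≡⟨ rec s b n ⟩
      H (suc b) n + shift (suc b) (F b) n
        ≡⟨ cong (_+ shift (suc b) (F b) n) (agree k (suc b) (subst (n ≤_) (ℕ.+-suc b k) n≤)) ⟩
      H′ (suc b) n + shift (suc b) (F b) n
        ≡⟨ rec s′ b n ⟨
      H′ b n        ∎
      where open ≡-Reasoning

  IsSum-resp : ∀ {F G H} → F ≗₂ G → IsSum F H → IsSum G H
  IsSum-resp {H = H} eq s .rec b n =
    trans (rec s b n) (cong (H (suc b) n +_) (shift-cong (suc b) (eq b) n))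
  IsSum-resp eq s .vanish = vanish s

  IsSum-⊕ : ∀ {F G H K} → IsSum F H → IsSum G K →
            IsSum (λ b → F b ⊕ G b) (λ b → H b ⊕ K b)
  IsSum-⊕ {F} {G} {H} {K} s t .rec b n = begin
    H b n + K b n
      ≡⟨ cong₂ _+_ (rec s b n) (rec t b n) ⟩
    (H (suc b) n + shift (suc b) (F b) n) + (K (suc b) n + shift (suc b) (G b) n)
      ≡⟨ lem (H (suc b) n) _ (K (suc b) n) _ ⟩
    (H (suc b) n + K (suc b) n) + (shift (suc b) (F b) n + shift (suc b) (G b) n)
      ≡⟨ cong (H (suc b) n + K (suc b) n +_) (shift-⊕ (suc b) (F b) (G b) n) ⟨
    (H (suc b) n + K (suc b) n) + shift (suc b) (F b ⊕ G b) n ∎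
    where
    open ≡-Reasoning
    lem : ∀ x y u v → (x + y) + (u + v) ≡ (x + u) + (y + v)
    lem = solve-∀
  IsSum-⊕ s t .vanish b n≤b = cong₂ _+_ (vanish s b n≤b) (vanish t b n≤b)

  IsSum-⊖ : ∀ {F H} → IsSum F H → IsSum (λ b → ⊖ F b) (λ b → ⊖ H b)
  IsSum-⊖ {F} {H} s .rec b n = begin
    - H b n                                      ≡⟨ cong -_ (rec s b n) ⟩
    - (H (suc b) n + shift (suc b) (F b) n)      ≡⟨ lem (H (suc b) n) _ ⟩
    - H (suc b) n + - shift (suc b) (F b) n      ≡⟨ cong (- H (suc b) n +_) (shift-⊖ (suc b) (F b) n) ⟨
    - H (suc b) n + shift (suc b) (⊖ F b) n      ∎
    where
    open ≡-Reasoning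
    lem : ∀ x y → - (x + y) ≡ - x + - y
    lem = solve-∀
  IsSum-⊖ s .vanish b n≤b = cong -_ (vanish s b n≤b)

  IsSum-D : ∀ a {F H} → IsSum F H → IsSum (D a ∘ F) (D a ∘ H)
  IsSum-D a {F} {H} s .rec b n = begin
    D a (H b) n                                          ≡⟨ D-cong a (rec s b) n ⟩
    D a (H (suc b) ⊕ shift (suc b) (F b)) n              ≡⟨ D-⊕ a (H (suc b)) _ n ⟩
    D a (H (suc b)) n + D a (shift (suc b) (F b)) n      ≡⟨ cong (D a (H (suc b)) n +_) (shift-D (suc b) a (F b) n) ⟨
    D a (H (suc b)) n + shift (suc b) (D a (F b)) n      ∎
    where open ≡-Reasoning
  IsSum-D a {F} {H} s .vanish b {n} n≤b = cong₂ _-_ (vanish s b n≤b)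
    (trans (shift-suc-local a {g = λ _ → 0ℤ} λ m m<n → vanish s b (ℕ.≤-trans (ℕ.<⇒≤ m<n) n≤b))
           (shift-0 (suc a) n))
    where
    shift-0 : ∀ k n → shift k (λ _ → 0ℤ) n ≡ 0ℤ
    shift-0 zero    n       = refl
    shift-0 (suc k) zero    = refl
    shift-0 (suc k) (suc n) = shift-0 k n

  partialSum : Family → ℕ → Family
  partialSum F zero    b n = 0ℤ
  partialSum F (suc k) b n = shift (suc b) (F b) n + partialSum F k (suc b) n

  -- Coefficient n needs only the terms with index below b + n, since the later ones start beyond
  -- degree n.
  tailSum : Family → Family
  tailSum F b n = partialSum F n b n

  tailSum-isSum : ∀ F → IsSum F (tailSum F)
  tailSum-isSum F .rec b n = begin
    partialSum F n b n                             ≡⟨ +-identityʳ _ ⟨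
    partialSum F n b n + 0ℤ
      -- The term with index b + n is 0 in degree n; appending it allows the first term to be split
      -- off with n terms remaining.
      ≡⟨ cong (partialSum F n b n +_) (shift-small (suc (b ℕ.+ n)) (F (b ℕ.+ n)) (s≤s (ℕ.m≤n+m n b))) ⟨
    partialSum F n b n + t (b ℕ.+ n)               ≡⟨ rotate n b ⟩
    t b + partialSum F n (suc b) n                 ≡⟨ lem (t b) _ ⟩
    partialSum F n (suc b) n + t b                 ∎
    where
    open ≡-Reasoning
    t : ℕ → ℤ
    t c = shift (suc c) (F c) n
    lem : ∀ x y → x + y ≡ y + x
    lem = solve-∀
    assoc : ∀ x y z → x + y + z ≡ x + (y + z)
    assoc = solve-∀
    rotate : ∀ k b → partialSum F k b n + t (b ℕ.+ k) ≡ t b + partialSum F k (suc b) n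
    rotate zero    b = trans (cong (λ c → 0ℤ + t c) (ℕ.+-identityʳ b)) (lem 0ℤ (t b))
    rotate (suc k) b = begin
      t b + partialSum F k (suc b) n + t (b ℕ.+ suc k)
        ≡⟨ assoc (t b) _ _ ⟩
      t b + (partialSum F k (suc b) n + t (b ℕ.+ suc k))
        ≡⟨ cong (λ c → t b + (partialSum F k (suc b) n + t c)) (ℕ.+-suc b k) ⟩
      t b + (partialSum F k (suc b) n + t (suc b ℕ.+ k))
        ≡⟨ cong (t b +_) (rotate k (suc b)) ⟩
      t b + (t (suc b) + partialSum F k (suc (suc b)) n) ∎
  tailSum-isSum F .vanish b {n} n≤b = zeros n n≤b
    where
    zeros : ∀ k {b} → n ≤ b → partialSum F k b n ≡ 0ℤ
    zeros zero    _   = refl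
    zeros (suc k) n≤b = cong₂ _+_ (shift-small _ _ (s≤s n≤b)) (zeros k (ℕ.m≤n⇒m≤1+n n≤b))

  -- Tame families and their closure under summation.

  -- The combinations Σ cₘ Pₘ, whose coefficients cₘ are rational functions of z
  -- not depending on b.
  data Tame : Family → Set where
    window : ∀ m → Tame (P m)
    add    : ∀ {F G} → Tame F → Tame G → Tame (λ b → F b ⊕ G b)
    neg    : ∀ {F} → Tame F → Tame (λ b → ⊖ F b)
    quot   : ∀ a {F} → Tame (D a ∘ F) → Tame F
    respect   : ∀ {F G} → F ≗₂ G → Tame F → Tame G

  -- Summing `P-telescope` from b upwards leaves the first term minus the limit of `P (suc a) c` for
  -- growing c, which is `one`.
  P-sum : ∀ a → IsSum (D a ∘ P (2 ℕ.+ a)) (λ b → P (suc a) b ⊕ (⊖ one))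
  P-sum a .rec b n = begin
    P (suc a) b n - one n
      ≡⟨ lem (P (suc a) b n) (P (suc a) (suc b) n) (one n) ⟩
    (P (suc a) (suc b) n - one n) + (P (suc a) b n - P (suc a) (suc b) n)
      ≡⟨ cong (P (suc a) (suc b) n - one n +_) (P-telescope a b n) ⟨
    (P (suc a) (suc b) n - one n) + D a (shift (suc b) (P (2 ℕ.+ a) b)) n
      ≡⟨ cong (P (suc a) (suc b) n - one n +_) (shift-D (suc b) a (P (2 ℕ.+ a) b) n) ⟨
    (P (suc a) (suc b) n - one n) + shift (suc b) (D a (P (2 ℕ.+ a) b)) n ∎
    where
    open ≡-Reasoning
    lem : ∀ x y o → x - o ≡ (y - o) + (x - y)
    lem = solve-∀
  P-sum a .vanish b {n} n≤b = trans (cong (_- one n) (P-small (suc a) b n≤b)) (+-inverseʳ (one n))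

  -- For a window, `W` merges the factors into a single window of length 2 + d + m; having at least
  -- two factors, it telescopes after applying `D (d + m)`. The other cases are linearity, with
  -- `IsSum-unique` identifying H.
  Tame-sum : ∀ d {F H} → Tame F → IsSum (W (2 ℕ.+ d) F) H → Tame H
  Tame-sum d (window m) s =
    quot (d ℕ.+ m) (respect
      (IsSum-unique (P-sum (d ℕ.+ m))
        (IsSum-D (d ℕ.+ m) (IsSum-resp (W-W (2 ℕ.+ d) m (λ _ → one)) s)))
      (add (window (suc (d ℕ.+ m))) (neg (window 0))))
  Tame-sum d (add {F} {G} f g) s = respect
    (IsSum-unique (IsSum-resp (W-⊕ (2 ℕ.+ d) F G)
      (IsSum-⊕ (tailSum-isSum (W (2 ℕ.+ d) F)) (tailSum-isSum (W (2 ℕ.+ d) G)))) s)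
    (add (Tame-sum d f (tailSum-isSum (W (2 ℕ.+ d) F))) (Tame-sum d g (tailSum-isSum (W (2 ℕ.+ d) G))))
  Tame-sum d (neg {F} f) s = respect
    (IsSum-unique (IsSum-resp (W-⊖ (2 ℕ.+ d) F) (IsSum-⊖ (tailSum-isSum (W (2 ℕ.+ d) F)))) s)
    (neg (Tame-sum d f (tailSum-isSum (W (2 ℕ.+ d) F))))
  Tame-sum d (quot a {F} f) s =
    quot a (Tame-sum d f (IsSum-resp (D-W (2 ℕ.+ d) a F) (IsSum-D a s)))
  Tame-sum d (respect eq f) s =
    Tame-sum d f (IsSum-resp (λ b n → sym (W-cong (2 ℕ.+ d) eq b n)) s)

  -- sol ds b is the generating function of the partitions whose parts are all
  -- ≥ b + 1 and contain no chain starting at b + 1 with gaps ds.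
  sol : List ℕ → Family
  sol []       b = one
  sol (d ∷ ds) b = one ⊕ tailSum (W d (sol ds)) b

  sol-tame : ∀ {ds} → All (2 ≤_) ds → Tame (sol ds)
  sol-tame []                   = window 0
  sol-tame {suc (suc d) ∷ ds} (s≤s (s≤s z≤n) ∷ ps) =
    add (window 0) (Tame-sum d (sol-tame ps) (tailSum-isSum (W (2 ℕ.+ d) (sol ds))))

  -- Either the part b + 1 is absent, or one copy is removed. As the start of a chain, that copy
  -- leaves the parts b + 1, ..., b + d free and the shorter chain to be avoided from b + 1 + d on.
  sol-rec : ∀ d ds b n → sol (d ∷ ds) b n ≡ sol (d ∷ ds) (suc b) n + shift (suc b) (W d (sol ds) b) n
  sol-rec d ds b n = trans (cong (one n +_) (rec (tailSum-isSum (W d (sol ds))) b n)) (lem (one n) _ _)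
    where
    lem : ∀ x y z → x + (y + z) ≡ x + y + z
    lem = solve-∀

  sol-small : ∀ ds b {n} → n ≤ b → sol ds b n ≡ one n
  sol-small []       b n≤b = refl
  sol-small (d ∷ ds) b {n} n≤b =
    trans (cong (one n +_) (vanish (tailSum-isSum (W d (sol ds))) b n≤b)) (+-identityʳ _)

  -- Series with denominator a product of factors 1 - zᵃ⁺¹.

  Finite : PowerSeries → Set
  Finite f = ∃[ N ] ∀ {n} → N ≤ n → f n ≡ 0ℤ

  Finite-⊕ : ∀ {f g} → Finite f → Finite g → Finite (f ⊕ g)
  Finite-⊕ (M , p) (N , q) = M ℕ.+ N , λ le →
    cong₂ _+_ (p (ℕ.≤-trans (ℕ.m≤m+n M N) le)) (q (ℕ.≤-trans (ℕ.m≤n+m N M) le))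

  Finite-⊖ : ∀ {f} → Finite f → Finite (⊖ f)
  Finite-⊖ (N , p) = N , λ le → cong -_ (p le)

  Finite-shift : ∀ k {f} → Finite f → Finite (shift k f)
  Finite-shift zero    p       = p
  Finite-shift (suc k) p with N , q ← Finite-shift k p = suc N , λ { (s≤s le) → q le }

  Finite-D : ∀ a {f} → Finite f → Finite (D a f)
  Finite-D a p = Finite-⊕ p (Finite-⊖ (Finite-shift (suc a) p))

  Finite-one : Finite one
  Finite-one = 1 , λ { (s≤s _) → refl }

  -- Some product of factors 1 − zᵃ⁺¹ turns f into a polynomial.
  data Fractional : PowerSeries → Set where
    finite : ∀ {f} → Finite f → Fractional f
    quot   : ∀ a {f} → Fractional (D a f) → Fractional f

  Fractional-cong : ∀ {f g} → f ≗ g → Fractional f → Fractional g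
  Fractional-cong eq (finite (N , p)) = finite (N , λ le → trans (sym (eq _)) (p le))
  Fractional-cong eq (quot a p)       = quot a (Fractional-cong (D-cong a eq) p)

  Fractional-D : ∀ a {f} → Fractional f → Fractional (D a f)
  Fractional-D a (finite p)     = finite (Finite-D a p)
  Fractional-D a {f} (quot b p) = quot b (Fractional-cong (D-comm a b f) (Fractional-D a p))

  Finite-Fractional-⊕ : ∀ {f g} → Finite f → Fractional g → Fractional (f ⊕ g)
  Finite-Fractional-⊕ p (finite q)         = finite (Finite-⊕ p q)
  Finite-Fractional-⊕ {f} {g} p (quot a q) =
    quot a (Fractional-cong (λ n → sym (D-⊕ a f g n)) (Finite-Fractional-⊕ (Finite-D a p) q))

  -- The factors for f are cleared first, each also multiplying g; once f is finite,
  -- `Finite-Fractional-⊕` clears those for g.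
  Fractional-⊕ : ∀ {f g} → Fractional f → Fractional g → Fractional (f ⊕ g)
  Fractional-⊕ (finite p) q         = Finite-Fractional-⊕ p q
  Fractional-⊕ {f} {g} (quot a p) q =
    quot a (Fractional-cong (λ n → sym (D-⊕ a f g n)) (Fractional-⊕ p (Fractional-D a q)))

  Fractional-⊖ : ∀ {f} → Fractional f → Fractional (⊖ f)
  Fractional-⊖ (finite p)     = finite (Finite-⊖ p)
  Fractional-⊖ {f} (quot a p) = quot a (Fractional-cong (λ n → sym (D-⊖ a f n)) (Fractional-⊖ p))

  Fractional-W : ∀ e {F} → (∀ b → Fractional (F b)) → ∀ b → Fractional (W e F b)
  Fractional-W zero    p b = p b
  Fractional-W (suc e) {F} p b =
    quot b (Fractional-cong (λ n → sym (D-inv b (W e F (suc b)) n)) (Fractional-W e p (suc b)))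

  Tame⇒Fractional : ∀ {F} → Tame F → ∀ b → Fractional (F b)
  Tame⇒Fractional (window m)  b = Fractional-W m (λ _ → finite Finite-one) b
  Tame⇒Fractional (add f g)   b = Fractional-⊕ (Tame⇒Fractional f b) (Tame⇒Fractional g b)
  Tame⇒Fractional (neg f)     b = Fractional-⊖ (Tame⇒Fractional f b)
  Tame⇒Fractional (quot a f)  b = quot a (Tame⇒Fractional f b)
  Tame⇒Fractional (respect eq f) b = Fractional-cong (eq b) (Tame⇒Fractional f b)

  -- Cauchy products and rationality.

  ⊛-suc : ∀ f g n → (f ⊛ g) (suc n) ≡ f 0 * g (suc n) + ((f ∘ suc) ⊛ g) n
  ⊛-suc f g n = cong (λ l → f 0 * g (suc n) + foldr _+_ 0ℤ l) (trans
    (map-applyUpTo suc (λ i → f i * g (suc n ∸ i)) (suc n))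
    (sym (map-applyUpTo id (λ i → f (suc i) * g (n ∸ i)) (suc n))))

  ⊛-congˡ : ∀ {f f′} → f ≗ f′ → ∀ g → f ⊛ g ≗ f′ ⊛ g
  ⊛-congˡ eq g zero    = cong (λ x → x * g 0 + 0ℤ) (eq 0)
  ⊛-congˡ {f} {f′} eq g (suc n) = begin
    (f ⊛ g) (suc n)                          ≡⟨ ⊛-suc f g n ⟩
    f 0 * g (suc n) + ((f ∘ suc) ⊛ g) n
      ≡⟨ cong₂ (λ x y → x * g (suc n) + y) (eq 0) (⊛-congˡ (eq ∘ suc) g n) ⟩
    f′ 0 * g (suc n) + ((f′ ∘ suc) ⊛ g) n    ≡⟨ ⊛-suc f′ g n ⟨
    (f′ ⊛ g) (suc n)                         ∎
    where open ≡-Reasoning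

  0-⊛ : ∀ g n → ((λ _ → 0ℤ) ⊛ g) n ≡ 0ℤ
  0-⊛ g zero    = refl
  0-⊛ g (suc n) = trans (⊛-suc (λ _ → 0ℤ) g n) (cong (0ℤ +_) (0-⊛ g n))

  1-⊛ : ∀ g → one ⊛ g ≗ g
  1-⊛ g zero    = lem (g 0)
    where
    lem : ∀ x → 1ℤ * x + 0ℤ ≡ x
    lem = solve-∀
  1-⊛ g (suc n) = trans (⊛-suc one g n) (trans (cong (1ℤ * g (suc n) +_) (0-⊛ g n)) (lem (g (suc n))))
    where
    lem : ∀ x → 1ℤ * x + 0ℤ ≡ x
    lem = solve-∀

  ⊕-⊛ : ∀ f f′ g → (f ⊕ f′) ⊛ g ≗ (f ⊛ g) ⊕ (f′ ⊛ g)
  ⊕-⊛ f f′ g zero    = lem (f 0) (f′ 0) (g 0)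
    where
    lem : ∀ x y z → (x + y) * z + 0ℤ ≡ (x * z + 0ℤ) + (y * z + 0ℤ)
    lem = solve-∀
  ⊕-⊛ f f′ g (suc n) = begin
    ((f ⊕ f′) ⊛ g) (suc n)
      ≡⟨ ⊛-suc (f ⊕ f′) g n ⟩
    (f 0 + f′ 0) * g (suc n) + (((f ∘ suc) ⊕ (f′ ∘ suc)) ⊛ g) n
      ≡⟨ cong ((f 0 + f′ 0) * g (suc n) +_) (⊕-⊛ (f ∘ suc) (f′ ∘ suc) g n) ⟩
    (f 0 + f′ 0) * g (suc n) + (((f ∘ suc) ⊛ g) n + ((f′ ∘ suc) ⊛ g) n)
      ≡⟨ lem (f 0) (f′ 0) (g (suc n)) _ _ ⟩
    (f 0 * g (suc n) + ((f ∘ suc) ⊛ g) n) + (f′ 0 * g (suc n) + ((f′ ∘ suc) ⊛ g) n)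
      ≡⟨ cong₂ _+_ (⊛-suc f g n) (⊛-suc f′ g n) ⟨
    ((f ⊛ g) ⊕ (f′ ⊛ g)) (suc n) ∎
    where
    open ≡-Reasoning
    lem : ∀ x y z u v → (x + y) * z + (u + v) ≡ (x * z + u) + (y * z + v)
    lem = solve-∀

  ⊖-⊛ : ∀ f g → (⊖ f) ⊛ g ≗ ⊖ (f ⊛ g)
  ⊖-⊛ f g zero    = lem (f 0) (g 0)
    where
    lem : ∀ x z → - x * z + 0ℤ ≡ - (x * z + 0ℤ)
    lem = solve-∀
  ⊖-⊛ f g (suc n) = begin
    ((⊖ f) ⊛ g) (suc n)                              ≡⟨ ⊛-suc (⊖ f) g n ⟩
    - f 0 * g (suc n) + ((⊖ (f ∘ suc)) ⊛ g) n        ≡⟨ cong (- f 0 * g (suc n) +_) (⊖-⊛ (f ∘ suc) g n) ⟩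
    - f 0 * g (suc n) + - ((f ∘ suc) ⊛ g) n          ≡⟨ lem (f 0) (g (suc n)) _ ⟩
    - (f 0 * g (suc n) + ((f ∘ suc) ⊛ g) n)          ≡⟨ cong -_ (⊛-suc f g n) ⟨
    - (f ⊛ g) (suc n)                                ∎
    where
    open ≡-Reasoning
    lem : ∀ x z u → - x * z + - u ≡ - (x * z + u)
    lem = solve-∀

  shift-⊛ : ∀ k f g → shift k f ⊛ g ≗ shift k (f ⊛ g)
  shift-⊛ zero    f g n       = refl
  shift-⊛ (suc k) f g zero    = refl
  shift-⊛ (suc k) f g (suc n) = trans (⊛-suc (shift (suc k) f) g n)
    (trans (+-identityˡ _) (shift-⊛ k f g n))

  D-⊛ : ∀ a f g → D a f ⊛ g ≗ D a (f ⊛ g)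
  D-⊛ a f g n = begin
    ((f ⊕ (⊖ shift (suc a) f)) ⊛ g) n       ≡⟨ ⊕-⊛ f (⊖ shift (suc a) f) g n ⟩
    (f ⊛ g) n + ((⊖ shift (suc a) f) ⊛ g) n ≡⟨ cong ((f ⊛ g) n +_) (⊖-⊛ (shift (suc a) f) g n) ⟩
    (f ⊛ g) n - (shift (suc a) f ⊛ g) n     ≡⟨ cong (λ s → (f ⊛ g) n - s) (shift-⊛ (suc a) f g n) ⟩
    D a (f ⊛ g) n                           ∎
    where open ≡-Reasoning

  D-foldr : ∀ a as f → foldr D (D a f) as ≗ D a (foldr D f as)
  D-foldr a []       f n = refl
  D-foldr a (b ∷ as) f n = trans (D-cong b (D-foldr a as f) n) (D-comm b a (foldr D f as) n)

  denominator : ∀ {f} → Fractional f → ∃[ as ] Finite (foldr D f as)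
  denominator (finite p) = [] , p
  denominator {f} (quot a p) with as , N , q ← denominator p =
    a ∷ as , N , λ {n} le → trans (sym (D-foldr a as f n)) (q le)

  foldr-⊛ : ∀ as g → foldr D one as ⊛ g ≗ foldr D g as
  foldr-⊛ []       g n = 1-⊛ g n
  foldr-⊛ (a ∷ as) g n = trans (D-⊛ a (foldr D one as) g n) (D-cong a (foldr-⊛ as g) n)

  foldr-finite : ∀ as → Finite (foldr D one as)
  foldr-finite []       = Finite-one
  foldr-finite (a ∷ as) = Finite-D a (foldr-finite as)

  foldr-0 : ∀ as → foldr D one as 0 ≡ 1ℤ
  foldr-0 []       = refl
  foldr-0 (a ∷ as) = trans (+-identityʳ _) (foldr-0 as)

  ⟦applyUpTo⟧ : ∀ f N → (∀ {n} → N ≤ n → f n ≡ 0ℤ) → ⟦ applyUpTo f N ⟧ ≗ f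
  ⟦applyUpTo⟧ f zero    p n       = sym (p z≤n)
  ⟦applyUpTo⟧ f (suc N) p zero    = refl
  ⟦applyUpTo⟧ f (suc N) p (suc n) = ⟦applyUpTo⟧ (f ∘ suc) N (p ∘ s≤s) n

  -- The factors clearing f are gathered in a list; applying them to `one` gives Q, and applying
  -- them to f gives P.
  Fractional⇒IsRational : ∀ {f} → Fractional f → IsRational f
  Fractional⇒IsRational {f} p with denominator p
  ... | as , N , num with foldr-finite as
  ... | M , den =
    applyUpTo (foldr D f as) N , applyUpTo q M ,
    -- Every factor 1 - zᵃ⁺¹ has constant term 1, hence so does Q.
    (0 , λ eq → 1≢0 (trans (sym (foldr-0 as)) (trans (sym (⟦applyUpTo⟧ q M den 0)) eq))) ,
    λ n → begin
      (⟦ applyUpTo q M ⟧ ⊛ f) n         ≡⟨ ⊛-congˡ (⟦applyUpTo⟧ q M den) f n ⟩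
      (q ⊛ f) n                         ≡⟨ foldr-⊛ as f n ⟩
      foldr D f as n                    ≡⟨ ⟦applyUpTo⟧ (foldr D f as) N num n ⟨
      ⟦ applyUpTo (foldr D f as) N ⟧ n  ∎
    where
    open ≡-Reasoning
    q = foldr D one as
    1≢0 : 1ℤ ≢ 0ℤ
    1≢0 ()

module Counting where

  open import Data.Empty using (⊥-elim)
  import Data.Integer as ℤ
  open import Data.Integer using (ℤ; +_; 0ℤ)
  open import Data.Integer.Properties using (pos-+)
  open import Data.List using (List; []; _∷_; _++_; length; map)
  open import Data.List.Membership.Propositional using (_∈_)
  open import Data.List.Membership.Propositional.Properties using (∈-++⁺ˡ; ∈-++⁺ʳ; ∈-++⁻; ∈-map⁺; ∈-map⁻)
  open import Data.List.Membership.Propositional.Properties.WithK using (unique∧set⇒bag)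
  open import Data.List.Properties using (length-++; length-map; ∷-injectiveʳ)
  open import Data.List.Relation.Binary.BagAndSetEquality using (∼bag⇒↭)
  open import Data.List.Relation.Binary.Permutation.Propositional.Properties using (↭-length)
  open import Data.List.Relation.Unary.All as All using (All; []; _∷_)
  open import Data.List.Relation.Unary.AllPairs using (AllPairs; []; _∷_)
  open import Data.List.Relation.Unary.Any using (here)
  open import Data.List.Relation.Unary.Unique.Propositional using (Unique)
  import Data.List.Relation.Unary.Unique.Propositional.Properties as Unique
  open import Data.Nat as ℕ using (ℕ; zero; suc; _≤_; _<_; z≤n; s≤s; _+_)
  open import Data.Nat.ListAction using (sum)
  import Data.Nat.Properties as ℕ
  open import Data.Product using (∃-syntax; _×_; _,_; proj₁; proj₂)
  open import Data.Sum using (_⊎_; inj₁; inj₂; [_,_])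
  open import Function using (_∘_; _⇔_; mk⇔; Equivalence)
  open import Function.Properties.Equivalence using () renaming (sym to ⇔-sym; trans to ⇔-trans)
  open import Relation.Binary.PropositionalEquality hiding ([_])
  open import Relation.Nullary using (¬_; yes; no)
  open Series

  open Equivalence using (to; from)

  -- Counting finite sets of lists.

  record Count (P : List ℕ → Set) (z : ℤ) : Set where
    field
      elems  : List (List ℕ)
      unique : Unique elems
      ∈-elems : ∀ l → l ∈ elems ⇔ P l
      size   : + length elems ≡ z
  open Count

  Count-cong : ∀ {P Q z w} → (∀ l → P l ⇔ Q l) → z ≡ w → Count P z → Count Q w
  Count-cong eq z≡w c .elems = elems c
  Count-cong eq z≡w c .unique = unique c
  Count-cong eq z≡w c .∈-elems l = ⇔-trans (∈-elems c l) (eq l)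
  Count-cong eq z≡w c .size = trans (size c) z≡w

  -- Two duplicate-free lists with the same members are permutations of each other.
  Count-unique : ∀ {P z xs} → Count P z → Unique xs → (∀ l → l ∈ xs ⇔ P l) → + length xs ≡ z
  Count-unique c u ∈xs = trans
    (cong +_ (↭-length (∼bag⇒↭ (unique∧set⇒bag u (unique c)
      λ {l} → ⇔-trans (∈xs l) (⇔-sym (∈-elems c l))))))
    (size c)

  Count-∅ : ∀ {P} → (∀ l → ¬ P l) → Count P 0ℤ
  Count-∅ none .elems = []
  Count-∅ none .unique = []
  Count-∅ none .∈-elems l = mk⇔ (λ ()) (⊥-elim ∘ none l)
  Count-∅ none .size = refl

  Count-one : ∀ {P} n → (∀ l → P l ⇔ (l ≡ [] × n ≡ 0)) → Count P (one n)
  Count-one zero    eq .elems = [] ∷ []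
  Count-one zero    eq .unique = [] ∷ []
  Count-one zero    eq .∈-elems l =
    mk⇔ (λ { (here refl) → from (eq []) (refl , refl) }) (here ∘ proj₁ ∘ to (eq l))
  Count-one zero    eq .size = refl
  Count-one (suc n) eq = Count-∅ λ l p → ℕ.1+n≢0 (proj₂ (to (eq l) p))

  Count-⊎ : ∀ {P Q z w} → (∀ {l} → P l → ¬ Q l) → Count P z → Count Q w →
            Count (λ l → P l ⊎ Q l) (z ℤ.+ w)
  Count-⊎ disj c d .elems = elems c ++ elems d
  Count-⊎ disj c d .unique = Unique.++⁺ (unique c) (unique d)
    λ (∈c , ∈d) → disj (to (∈-elems c _) ∈c) (to (∈-elems d _) ∈d)
  Count-⊎ disj c d .∈-elems l = mk⇔
    (λ ∈cd → [ inj₁ ∘ to (∈-elems c l) , inj₂ ∘ to (∈-elems d l) ] (∈-++⁻ (elems c) ∈cd))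
    [ ∈-++⁺ˡ ∘ from (∈-elems c l) , ∈-++⁺ʳ (elems c) ∘ from (∈-elems d l) ]
  Count-⊎ disj c d .size = trans (cong +_ (length-++ (elems c)))
    (trans (pos-+ (length (elems c)) _) (cong₂ ℤ._+_ (size c) (size d)))

  Count-∷ : ∀ {P z} x → Count P z → Count (λ l → ∃[ l′ ] l ≡ x ∷ l′ × P l′) z
  Count-∷ x c .elems = map (x ∷_) (elems c)
  Count-∷ x c .unique = Unique.map⁺ ∷-injectiveʳ (unique c)
  Count-∷ x c .∈-elems l = mk⇔
    (λ ∈m → let l′ , ∈c , eq = ∈-map⁻ (x ∷_) ∈m in l′ , eq , to (∈-elems c l′) ∈c)
    λ { (l′ , refl , p) → ∈-map⁺ (x ∷_) (from (∈-elems c l′) p) }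
  Count-∷ x c .size = trans (cong +_ (length-map (x ∷_) (elems c))) (size c)

  Prepend : ℕ → (ℕ → List ℕ → Set) → ℕ → List ℕ → Set
  Prepend B Y n l = ∃[ l′ ] l ≡ B ∷ l′ × ∃[ m ] B + m ≡ n × Y m l′

  -- A new part B adds B to the sum, hence multiplication by zᴮ; for n < B there is nothing to
  -- count.
  Count-Prepend : ∀ B Y f n → (∀ m → B + m ≡ n → Count (Y m) (f m)) →
                  Count (Prepend B Y n) (shift B f n)
  Count-Prepend B Y f n c with B ℕ.≤? n
  ... | no B≰n = subst (Count _) (sym (shift-small B f (ℕ.≰⇒> B≰n)))
    (Count-∅ λ { l (l′ , _ , m , refl , _) → B≰n (ℕ.m≤m+n B m) })
  ... | yes B≤n with m , refl ← ℕ.m≤n⇒∃[o]m+o≡n B≤n =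
    Count-cong
      (λ l → mk⇔ (λ (l′ , eq , y) → l′ , eq , m , refl , y)
        λ { (l′ , eq , m′ , eq′ , y) →
          l′ , eq , subst (λ i → Y i l′) (ℕ.+-cancelˡ-≡ B m′ m eq′) y })
      (sym (shift-+ B f m)) (Count-∷ B (c m refl))

  -- Chains in a list of parts.

  -- Chain c (d₁ ∷ … ∷ dₖ ∷ []) l: l has a subsequence x₀, …, xₖ with x₀ ≥ c and
  -- xᵢ ≥ xᵢ₋₁ + dᵢ.
  data Chain : ℕ → List ℕ → List ℕ → Set where
    skip : ∀ {c ds x l} → Chain c ds l → Chain c ds (x ∷ l)
    last : ∀ {c x l} → c ≤ x → Chain c [] (x ∷ l)
    take : ∀ {c d ds x l} → c ≤ x → Chain (x + d) ds l → Chain c (d ∷ ds) (x ∷ l)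

  Chain-antitone : ∀ {c c′ ds l} → c′ ≤ c → Chain c ds l → Chain c′ ds l
  Chain-antitone le (skip ch)   = skip (Chain-antitone le ch)
  Chain-antitone le (last p)    = last (ℕ.≤-trans le p)
  Chain-antitone le (take p ch) = take (ℕ.≤-trans le p) ch

  Chain-raise : ∀ {c ds l} → All (suc c ≤_) l → Chain c ds l → Chain (suc c) ds l
  Chain-raise (_ ∷ ps) (skip ch)   = skip (Chain-raise ps ch)
  Chain-raise (p ∷ _)  (last _)    = last p
  Chain-raise (p ∷ _)  (take _ ch) = take p ch

  -- Dropping x₀ leaves a chain that starts at x₁ ≥ x₀ + d ≥ c + d.
  Chain-tail : ∀ {c d ds l} → Chain c (d ∷ ds) l → Chain (c + d) ds l
  Chain-tail         (skip ch)   = skip (Chain-tail ch)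
  Chain-tail {d = d} (take p ch) = skip (Chain-antitone (ℕ.+-monoˡ-≤ d p) ch)

  Chain-below : ∀ {c ds x l} → x < c → Chain c ds (x ∷ l) ⇔ Chain c ds l
  Chain-below x<c = mk⇔
    (λ { (skip ch) → ch ; (last p) → ⊥-elim (ℕ.<⇒≱ x<c p) ; (take p _) → ⊥-elim (ℕ.<⇒≱ x<c p) })
    skip

  -- Choosing the smallest candidate is optimal.
  Chain-greedy : ∀ {c d ds l} → Chain c (d ∷ ds) (c ∷ l) ⇔ Chain (c + d) ds l
  Chain-greedy = mk⇔ (λ { (skip ch) → Chain-tail ch ; (take _ ch) → ch }) (take ℕ.≤-refl)

  -- Counting partitions without a given chain.

  -- The bound B on the parts is separate from the threshold c of the chain, so that parts B, ..., c
  -- - 1 may occur freely. Parts increase, so a chain is read from the smallest part upwards.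
  Missing : (B c : ℕ) (ds : List ℕ) (n : ℕ) (l : List ℕ) → Set
  Missing B c ds n l = All (B ≤_) l × AllPairs _≤_ l × sum l ≡ n × ¬ Chain c ds l

  -- Case split on whether the least part is B. If so, one copy is removed, B stays allowed because
  -- it may repeat, and `eq` translates the chain condition.
  Missing-step : ∀ {B c ds c′ ds′} → (∀ {l} → Chain c ds (B ∷ l) ⇔ Chain c′ ds′ l) →
           ∀ n l → (Missing (suc B) c ds n l ⊎ Prepend B (Missing B c′ ds′) n l) ⇔ Missing B c ds n l
  Missing-step {B} {c} {ds} {c′} {ds′} eq n l = mk⇔
    (λ { (inj₁ (ps , asc , s , ¬ch)) → All.map ℕ.<⇒≤ ps , asc , s , ¬ch
       ; (inj₂ (l′ , refl , m , refl , ps , asc , refl , ¬ch)) →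
           (ℕ.≤-refl ∷ ps) , (ps ∷ asc) , refl , ¬ch ∘ to eq })
    split
    where
    split : ∀ {l} → Missing B c ds n l → Missing (suc B) c ds n l ⊎ Prepend B (Missing B c′ ds′) n l
    split {[]} (ps , rest) = inj₁ ([] , rest)
    split {x ∷ l} (p ∷ ps , asc@(qs ∷ asc′) , s , ¬ch) with ℕ.m≤n⇒m<n∨m≡n p
    ... | inj₁ B<x  = inj₁ (B<x ∷ All.map (ℕ.<-≤-trans B<x) qs , asc , s , ¬ch)
    ... | inj₂ refl = inj₂ (l , refl , sum l , s , ps , asc′ , refl , ¬ch ∘ from eq)

  Missing-disjoint : ∀ {B c ds n c′ ds′ l} → Missing (suc B) c ds n l → ¬ Prepend B (Missing B c′ ds′) n l
  Missing-disjoint (B<B ∷ _ , _) (_ , refl , _) = ℕ.<-irrefl refl B<B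

  Missing-raise : ∀ B ds n l → Missing (suc B) (suc B) ds n l ⇔ Missing (suc B) B ds n l
  Missing-raise B ds n l = mk⇔
    (λ (ps , asc , s , ¬ch) → ps , asc , s , ¬ch ∘ Chain-raise ps)
    (λ (ps , asc , s , ¬ch) → ps , asc , s , ¬ch ∘ Chain-antitone (ℕ.n≤1+n B))

  Missing-small : ∀ {b n} c ds → n ≤ b → Count (Missing (suc b) c ds n) (one n)
  Missing-small {b} {n} c ds n≤b = Count-one n λ l → mk⇔ only-[] λ { (refl , refl) → [] , [] , refl , λ () }
    where
    only-[] : ∀ {l} → Missing (suc b) c ds n l → l ≡ [] × n ≡ 0
    only-[] {[]}    (_ , _ , s , _) = refl , sym s
    only-[] {x ∷ l} (p ∷ _ , _ , refl , _) =
      ⊥-elim (ℕ.<⇒≱ p (ℕ.≤-trans (ℕ.m≤m+n x (sum l)) n≤b))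

  Missing-[] : ∀ B n → Count (Missing B B [] n) (one n)
  Missing-[] B n = Count-one n λ l → mk⇔ only-[] λ { (refl , refl) → [] , [] , refl , λ () }
    where
    only-[] : ∀ {l} → Missing B B [] n l → l ≡ [] × n ≡ 0
    only-[] {[]}    (_ , _ , s , _) = refl , sym s
    only-[] {x ∷ l} (p ∷ _ , _ , _ , ¬ch) = ⊥-elim (¬ch (last p))

  -- The e part sizes b + 1, ..., b + e lie below the threshold and are unrestricted; they account
  -- for the factors in `W e`.
  Counted : ℕ → ℕ → Set
  Counted b n = ∀ ds e → Count (Missing (suc b) (suc b + e) ds n) (W e (sol ds) b n)

  Counted-small : ∀ {b n} → n ≤ b → Counted b n
  Counted-small {b} n≤b ds e =
    subst (Count _) (sym (W-small e (sol ds) (sol-small ds) b n≤b)) (Missing-small _ ds n≤b)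

  Count-threshold : ∀ {B c c′ ds n z} → c ≡ c′ → Count (Missing B c ds n) z → Count (Missing B c′ ds n) z
  Count-threshold refl count = count

  -- For e = 0 the part b + 1 starts the chain and opens a window of d free sizes, matching
  -- `sol-rec`; for e > 0 it cannot join the chain, matching `inv-rec`.
  Counted-step : ∀ {b n} → Counted (suc b) n → (∀ m → suc b + m ≡ n → Counted b m) → Counted b n
  Counted-step {b} {n} _ _ [] zero =
    Count-threshold (sym (ℕ.+-identityʳ (suc b))) (Missing-[] (suc b) n)
  Counted-step {b} {n} above less (d ∷ ds) zero =
    Count-threshold (sym (ℕ.+-identityʳ (suc b)))
      (Count-cong (Missing-step Chain-greedy n) (sym (sol-rec d ds b n)) (Count-⊎ Missing-disjoint
        (Count-cong (Missing-raise (suc b) (d ∷ ds) n) refl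
          (Count-threshold (ℕ.+-identityʳ (2 + b)) (above (d ∷ ds) zero)))
        (Count-Prepend (suc b) _ _ n λ m eq → less m eq ds d)))
  Counted-step {b} {n} above less ds (suc e) =
    Count-cong (Missing-step (Chain-below (ℕ.m<m+n (suc b) (s≤s z≤n))) n)
      (sym (inv-rec b (W e (sol ds) (suc b)) n))
      (Count-⊎ Missing-disjoint
        (Count-threshold (sym (ℕ.+-suc (suc b) e)) (above ds e))
        (Count-Prepend (suc b) _ _ n λ m eq → less m eq ds (suc e)))

  -- Removing a part lowers n, bounded by N; raising b lowers the distance k to the case n ≤ b,
  -- where at most the empty list remains.
  counted : ∀ b n → Counted b n
  counted b n = bounded n n b ℕ.≤-refl (ℕ.m≤n+m n b)
    where
    bounded : ∀ N k b {n} → n ≤ N → n ≤ b + k → Counted b n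
    bounded zero    k       b z≤n _     = Counted-small z≤n
    bounded (suc N) zero    b _   n≤b+0 = Counted-small (subst (_ ≤_) (ℕ.+-identityʳ b) n≤b+0)
    bounded (suc N) (suc k) b {n} n≤N n≤b+k = Counted-step
      (bounded (suc N) k (suc b) n≤N (subst (n ≤_) (ℕ.+-suc b k) n≤b+k))
      λ { m refl → bounded N m b (ℕ.≤-trans (ℕ.m≤n+m m b) (ℕ.≤-pred n≤N)) (ℕ.m≤n+m m b) }

module Containment where

  open import Data.Bool using (true; false; T)
  open import Data.Empty using (⊥-elim)
  open import Data.Fin using (toℕ)
  open import Data.Fin.Subset using (Subset; ∣_∣; _∩_)
  open import Data.Integer as ℤ using (0ℤ)
  import Data.Integer.Properties as ℤ
  open import Data.List using (List; []; _∷_; length; map; filter; reverse)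
  open import Data.List.Membership.Propositional using (_∈_)
  open import Data.List.Membership.Propositional.Properties using (∈-map⁺; ∈-map⁻)
  open import Data.List.Properties using (filter-all; filter-accept; filter-reject; map-cong-local; reverse-map; reverse-involutive; reverse-injective; unfold-reverse; map-∘; length-map)
  open import Data.List.Relation.Binary.Permutation.Propositional using (↭-sym)
  open import Data.List.Relation.Binary.Permutation.Propositional.Properties using (↭-reverse; All-resp-↭)
  open import Data.List.Relation.Binary.Sublist.Propositional using (_⊆_; []; _∷_; _∷ʳ_; minimum)
  open import Data.List.Relation.Binary.Sublist.Propositional.Properties using (All-resp-⊆; reverse⁺)
  open import Data.List.Relation.Unary.All as All using (All; []; _∷_)
  import Data.List.Relation.Unary.All.Properties as All
  open import Data.List.Relation.Unary.AllPairs as AllPairs using (AllPairs; []; _∷_)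
  import Data.List.Relation.Unary.AllPairs.Properties as AllPairs
  open import Data.List.Relation.Unary.Any using (here)
  open import Data.List.Relation.Unary.Linked.Properties using (Linked⇒AllPairs; AllPairs⇒Linked)
  import Data.List.Relation.Unary.Unique.Propositional.Properties as Unique
  open import Data.Nat using (ℕ; zero; suc; _+_; _∸_; _⊔_; _≤_; _<_; _≥_; _<ᵇ_; z≤n; s≤s; ∣_-_∣)
  open import Data.Nat.ListAction.Properties using (sum-↭)
  open import Data.Nat.Properties
  open import Data.Product using (∃-syntax; _×_; _,_; proj₁; proj₂)
  open import Data.Vec using ([]; _∷_; tabulate)
  open import Function using (_∘_; id; flip; _⇔_; mk⇔; Equivalence)
  open import Relation.Binary.PropositionalEquality hiding ([_])
  open import Relation.Nullary using (yes; no)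
  open Series
  open Counting

  open Equivalence using (to; from)

  -- Deleting rows and columns.

  AllPairs-reverse : ∀ {A : Set} {R : A → A → Set} {xs} → AllPairs R xs → AllPairs (flip R) (reverse xs)
  AllPairs-reverse [] = []
  AllPairs-reverse {R = R} {x ∷ xs} (px ∷ pxs) = subst (AllPairs (flip R)) (sym (unfold-reverse x xs))
    (AllPairs.++⁺ (AllPairs-reverse pxs) ([] ∷ [])
      (All.map (_∷ []) (All-resp-↭ (↭-sym (↭-reverse xs)) px)))

  select-⊆ : ∀ (xs : List ℕ) R → select xs R ⊆ xs
  select-⊆ []       []          = []
  select-⊆ (x ∷ xs) (true  ∷ R) = refl ∷ select-⊆ xs R
  select-⊆ (x ∷ xs) (false ∷ R) = x ∷ʳ select-⊆ xs R

  ⊆-select : ∀ {s xs : List ℕ} → s ⊆ xs → ∃[ R ] select xs R ≡ s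
  ⊆-select []         = [] , refl
  ⊆-select (x ∷ʳ p)   with R , eq ← ⊆-select p = false ∷ R , eq
  ⊆-select (refl ∷ p) with R , eq ← ⊆-select p = true ∷ R , cong (_ ∷_) eq

  -- A row emptied by the column deletions may as well be deleted itself.
  filter-map-⊆ : ∀ (g : ℕ → ℕ) {xs s} → s ⊆ xs →
                 ∃[ t ] t ⊆ xs × map g t ≡ filter (0 <?_) (map g s)
  filter-map-⊆ g []       = [] , [] , refl
  filter-map-⊆ g (x ∷ʳ p) with t , q , eq ← filter-map-⊆ g p = t , x ∷ʳ q , eq
  filter-map-⊆ g (_∷_ {x} refl p) with filter-map-⊆ g p | 0 <? g x
  ... | t , q , eq | yes pos = x ∷ t , refl ∷ q , trans (cong (g x ∷_) eq) (sym (filter-accept (0 <?_) pos))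
  ... | t , q , eq | no ¬pos = t , x ∷ʳ q , trans eq (sym (filter-reject (0 <?_) ¬pos))

  width-bound : ∀ α → All (_≤ width α) α
  width-bound []      = []
  width-bound (a ∷ α) =
    m≤m⊔n a (width α) ∷ All.map (λ le → ≤-trans le (m≤n⊔m a (width α))) (width-bound α)

  row-zero : ∀ {w} (C : Subset w) → ∣ row w 0 ∩ C ∣ ≡ 0
  row-zero []      = refl
  row-zero (_ ∷ C) = row-zero C

  row-suc : ∀ {w} (C : Subset w) a → ∣ row w (suc a) ∩ C ∣ ≤ suc ∣ row w a ∩ C ∣
  row-suc []          a       = z≤n
  row-suc (true ∷ C)  zero    = s≤s (≤-reflexive (trans (row-zero C) (sym (row-zero C))))
  row-suc (false ∷ C) zero    = m≤n⇒m≤1+n ≤-refl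
  row-suc (true ∷ C)  (suc a) = s≤s (row-suc C a)
  row-suc (false ∷ C) (suc a) = row-suc C a

  row-+ : ∀ {w} (C : Subset w) a k → ∣ row w (a + k) ∩ C ∣ ≤ ∣ row w a ∩ C ∣ + k
  row-+ C a zero    rewrite +-identityʳ a = m≤m+n _ 0
  row-+ C a (suc k) rewrite +-suc a k =
    ≤-trans (row-suc C (a + k)) (≤-trans (s≤s (row-+ C a k)) (≤-reflexive (sym (+-suc _ k))))

  -- From containment to chains.

  gaps : ℕ → List ℕ → List ℕ
  gaps m []       = []
  gaps m (k ∷ ν) = (k ∸ m) ∷ gaps k ν

  -- By `lip`, the difference of two values of f is at most that of the arguments, so the arguments
  -- are spaced at least as widely as the gaps demand.
  Chain-map : ∀ (f : ℕ → ℕ) → (∀ a k → f (a + k) ≤ f a + k) →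
              ∀ {x t l c} → AllPairs _≤_ l → x ∷ t ⊆ l → c ≤ x → Chain c (gaps (f x) (map f t)) l
  Chain-map f lip (_ ∷ asc) (_ ∷ʳ p) c≤x = skip (Chain-map f lip asc p c≤x)
  Chain-map f lip {t = []}        _           (refl ∷ _) c≤x = last c≤x
  Chain-map f lip {x} {t = y ∷ t} (x≤ ∷ asc) (refl ∷ p) c≤x with All-resp-⊆ p x≤
  ... | x≤y ∷ _ = take c≤x (Chain-map f lip asc p (begin
    x + (f y ∸ f x)               ≡⟨ cong (λ i → x + (f i ∸ f x)) (m+[n∸m]≡n x≤y) ⟨
    x + (f (x + (y ∸ x)) ∸ f x)   ≤⟨ +-monoʳ-≤ x (∸-monoˡ-≤ (f x) (lip x (y ∸ x))) ⟩
    x + (f x + (y ∸ x) ∸ f x)     ≡⟨ cong (x +_) (m+n∸m≡n (f x) (y ∸ x)) ⟩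
    x + (y ∸ x)                   ≡⟨ m+[n∸m]≡n x≤y ⟩
    y                             ∎))
    where open ≤-Reasoning

  Contains⇒Chain : ∀ {α μ m ν} → AllPairs _≥_ α → reverse μ ≡ m ∷ ν → α Contains μ →
                   Chain m (gaps m ν) (reverse α)
  Contains⇒Chain {α} {μ} {m} {ν} desc rev (R , C , restr)
    with t , t⊆α , eq ← filter-map-⊆ (λ a → ∣ row (width α) a ∩ C ∣) (select-⊆ α R)
    = go (reverse t) (reverse⁺ t⊆α)
         (trans (reverse-map f t) (trans (cong reverse (trans eq restr)) rev))
    where
    f : ℕ → ℕ
    f a = ∣ row (width α) a ∩ C ∣
    go : ∀ s → s ⊆ reverse α → map f s ≡ m ∷ ν → Chain m (gaps m ν) (reverse α)
    go (x ∷ s) s⊆ refl = Chain-map f (row-+ C) (AllPairs-reverse desc) s⊆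
      -- An empty row keeps no boxes, so the Lipschitz bound from 0 gives f x ≤ x.
      (≤-trans (row-+ C 0 x) (≤-reflexive (cong (_+ x) (row-zero C))))

  -- From chains to containment: columns with prescribed counts.

  -- Points (x , k) asking for an interval [0 , x) that holds k chosen columns.

  Gap : ℕ × ℕ → ℕ × ℕ → Set
  Gap (x , m) (y , k) = m ≤ k × x + k ≤ y + m

  -- The left side is the value at x of the ramp of slope 1 that `envelope` places below (y , k).
  Close : ℕ × ℕ → ℕ × ℕ → Set
  Close (x , m) (y , k) = k ∸ (y ∸ x) ≤ m

  -- The last conjunct is the second half of `Gap` from a virtual point (c , m); it carries the
  -- induction, and for c = m it says k ≤ x.
  Chain⇒points : ∀ {c m ν l} → AllPairs _≤_ (m ∷ ν) → Chain c (gaps m ν) l →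
    ∃[ p ] map proj₁ p ⊆ l × map proj₂ p ≡ m ∷ ν × AllPairs Gap p ×
           All (λ (x , k) → c + k ≤ x + m) p
  Chain⇒points {ν = []} asc (skip ch) with p , s , rest ← Chain⇒points asc ch = p , _ ∷ʳ s , rest
  Chain⇒points {ν = _ ∷ _} asc (skip ch) with p , s , rest ← Chain⇒points asc ch = p , _ ∷ʳ s , rest
  Chain⇒points {m = m} {ν = []} _ (last {x = x} c≤x) =
    (x , m) ∷ [] , refl ∷ minimum _ , refl , [] ∷ [] , +-monoˡ-≤ m c≤x ∷ []
  Chain⇒points {c} {m} {k ∷ ν} (m≤ ∷ asc) (take {x = x} c≤x ch)
    with p , s , eq , gap , bound ← Chain⇒points asc ch =
    (x , m) ∷ p , refl ∷ s , cong (m ∷_) eq ,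
    All.zipWith id (m≤p , bound′) ∷ gap ,
    +-monoˡ-≤ m c≤x ∷ All.map (λ {(y , j)} → ≤-trans (+-monoˡ-≤ j c≤x)) bound′
    where
    m≤p = All.map⁻ (subst (All (m ≤_)) (sym eq) m≤)
    k≡ : k ≡ k ∸ m + m
    k≡ = sym (m∸n+n≡m (All.head m≤))
    open ≤-Reasoning
    -- The recursive bound is relative to (x + (k ∸ m) , k); lowering both coordinates by k ∸ m
    -- makes it relative to (x , m).
    bound′ : All (λ (y , j) → x + j ≤ y + m) p
    bound′ = All.map (λ {(y , j)} le → +-cancelʳ-≤ (k ∸ m) _ _ (begin
      x + j + (k ∸ m)   ≡⟨ +-assoc x j _ ⟩
      x + (j + (k ∸ m)) ≡⟨ cong (x +_) (+-comm j _) ⟩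
      x + (k ∸ m + j)   ≡⟨ +-assoc x _ j ⟨
      x + (k ∸ m) + j   ≤⟨ le ⟩
      y + k             ≡⟨ cong (y +_) (trans k≡ (+-comm (k ∸ m) m)) ⟩
      y + (m + (k ∸ m)) ≡⟨ +-assoc y m _ ⟨
      y + m + (k ∸ m)   ∎)) bound

  Gap⇒Close : ∀ {u v} → Gap u v → Close u v
  Gap⇒Close {x , m} {y , k} (_ , le) = m≤n+o⇒m∸n≤o k (y ∸ x) (+-cancelˡ-≤ x _ _ (begin
    x + k             ≤⟨ le ⟩
    y + m             ≤⟨ +-monoˡ-≤ m (m≤n+m∸n y x) ⟩
    x + (y ∸ x) + m   ≡⟨ +-assoc x _ m ⟩
    x + (y ∸ x + m)   ∎))
    where open ≤-Reasoning

  Gap⇒Close˘ : ∀ {u v} → Gap u v → Close v u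
  Gap⇒Close˘ {x , m} {y , k} (m≤k , _) = ≤-trans (m∸n≤m m (x ∸ y)) m≤k

  AllPairs⇒All-All : ∀ {A : Set} {R tailSum : A → A → Set} → (∀ {u} → tailSum u u) →
    (∀ {u v} → R u v → tailSum u v) → (∀ {u v} → R u v → tailSum v u) →
    ∀ {p} → AllPairs R p → All (λ u → All (tailSum u) p) p
  AllPairs⇒All-All rfl fwd bwd []         = []
  AllPairs⇒All-All rfl fwd bwd (px ∷ pxs) =
    (rfl ∷ All.map fwd px) ∷
    All.zipWith (λ (r , all) → bwd r ∷ all) (px , AllPairs⇒All-All rfl fwd bwd pxs)

  -- The least 1-Lipschitz function whose value at x is at least k for all the
  -- points (x , k).
  envelope : List (ℕ × ℕ) → ℕ → ℕ
  envelope []            a = 0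
  envelope ((x , k) ∷ p) a = (k ∸ (x ∸ a)) ⊔ envelope p a

  envelope-zero : ∀ {p} → All (λ (x , k) → k ≤ x) p → envelope p 0 ≡ 0
  envelope-zero []         = refl
  envelope-zero (k≤x ∷ ps) = cong₂ _⊔_ (m≤n⇒m∸n≡0 k≤x) (envelope-zero ps)

  envelope-mono : ∀ p a → envelope p a ≤ envelope p (suc a)
  envelope-mono []            a = z≤n
  envelope-mono ((x , k) ∷ p) a =
    ⊔-mono-≤ (∸-monoʳ-≤ k (∸-monoʳ-≤ x (n≤1+n a))) (envelope-mono p a)

  envelope-suc : ∀ p a → envelope p (suc a) ≤ suc (envelope p a)
  envelope-suc []            a = z≤n
  envelope-suc ((x , k) ∷ p) a = ⊔-mono-≤ (step k x a) (envelope-suc p a)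
    where
    step : ∀ k x a → k ∸ (x ∸ suc a) ≤ suc (k ∸ (x ∸ a))
    step k       zero    zero    = n≤1+n k
    step zero    (suc x) zero    = ≤-trans (≤-reflexive (0∸n≡0 x)) z≤n
    step (suc k) (suc x) zero    = ≤-trans (∸-monoˡ-≤ x (≤-refl {suc k})) (suc-∸ k x)
      where
      suc-∸ : ∀ k x → suc k ∸ x ≤ suc (k ∸ x)
      suc-∸ k       zero    = ≤-refl
      suc-∸ zero    (suc x) = ≤-trans (≤-reflexive (0∸n≡0 x)) z≤n
      suc-∸ (suc k) (suc x) = suc-∸ k x
    step k       zero    (suc a) = n≤1+n k
    step k       (suc x) (suc a) = step k x a

  envelope-upper : ∀ {x m p} → All (Close (x , m)) p → envelope p x ≤ m
  envelope-upper []       = z≤n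
  envelope-upper (c ∷ cs) = ⊔-lub c (envelope-upper cs)

  envelope-lower : ∀ (p : List (ℕ × ℕ)) → All (λ (x , k) → k ≤ envelope p x) p
  envelope-lower []            = []
  envelope-lower ((x , k) ∷ p) =
    ≤-trans (≤-reflexive (cong (k ∸_) (sym (n∸n≡0 x)))) (m≤m⊔n _ _) ∷
    All.map (λ le → ≤-trans le (m≤n⊔m _ _)) (envelope-lower p)

  -- Each point's own ramp reaches it, and `Gap` keeps the ramps of all other points from rising
  -- above it.
  envelope-fits : ∀ {p} → AllPairs Gap p → All (λ (x , k) → envelope p x ≡ k) p
  envelope-fits {p} gap = All.zipWith
    (λ (close , le) → ≤-antisym (envelope-upper close) le)
    (AllPairs⇒All-All (λ {(x , k)} → m∸n≤m k (x ∸ x)) Gap⇒Close Gap⇒Close˘ gap , envelope-lower p)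

  -- The positions where f steps up: if all steps are 0 or 1, the number chosen below a telescopes
  -- to f a - f 0.
  columns : ∀ w → (ℕ → ℕ) → Subset w
  columns w f = tabulate λ j → f (toℕ j) <ᵇ f (suc (toℕ j))

  columns-count : ∀ {w} f → (∀ a → f a ≤ f (suc a)) → (∀ a → f (suc a) ≤ suc (f a)) →
                  ∀ {a} → a ≤ w → ∣ row w a ∩ columns w f ∣ + f 0 ≡ f a
  columns-count {w} f mono lip {zero} _ = cong (_+ f 0) (row-zero (columns w f))
  columns-count {suc w} f mono lip {suc a} (s≤s a≤w)
    with f 0 <ᵇ f 1 in eq | columns-count {w} (f ∘ suc) (mono ∘ suc) (lip ∘ suc) a≤w
  ... | true  | ih = begin
    suc (tail + f 0)   ≡⟨ +-suc tail (f 0) ⟨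
    tail + suc (f 0)   ≡⟨ cong (tail +_) (≤-antisym (<ᵇ⇒< (f 0) (f 1) (subst T (sym eq) _)) (lip 0)) ⟩
    tail + f 1         ≡⟨ ih ⟩
    f (suc a)          ∎
    where
    open ≡-Reasoning
    tail = ∣ row w a ∩ columns w (f ∘ suc) ∣
  ... | false | ih = begin
    tail + f 0         ≡⟨ cong (tail +_) (≤-antisym (mono 0) (≮⇒≥ λ lt → subst T eq (<⇒<ᵇ lt))) ⟩
    tail + f 1         ≡⟨ ih ⟩
    f (suc a)          ∎
    where
    open ≡-Reasoning
    tail = ∣ row w a ∩ columns w (f ∘ suc) ∣

  -- The rows kept are the members of the chain and the columns kept are the steps of the envelope,
  -- so that a row of length x retains `envelope p x` boxes, the part of μ assigned to it.
  Chain⇒Contains : ∀ {α μ m ν} → All (0 <_) μ → AllPairs _≥_ μ → reverse μ ≡ m ∷ ν →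
                   Chain m (gaps m ν) (reverse α) → α Contains μ
  Chain⇒Contains {α} {μ} {m} {ν} pos desc rev ch
    with p , s , eq , gap , bound ← Chain⇒points (subst (AllPairs _≤_) rev (AllPairs-reverse desc)) ch
    with R , selR ← ⊆-select (subst (reverse (map proj₁ p) ⊆_) (reverse-involutive α) (reverse⁺ s)) =
    R , C , (begin
      filter (0 <?_) (map g (select α R))
        ≡⟨ cong (filter (0 <?_)) (map-cong-local (All.map g≡f (All-resp-⊆ (select-⊆ α R) (width-bound α)))) ⟩
      filter (0 <?_) (map f (select α R))
        ≡⟨ cong (λ t → filter (0 <?_) (map f t)) selR ⟩
      filter (0 <?_) (map f (reverse (map proj₁ p)))
        ≡⟨ cong (filter (0 <?_)) (reverse-map f (map proj₁ p)) ⟩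
      filter (0 <?_) (reverse (map f (map proj₁ p)))
        ≡⟨ cong (filter (0 <?_) ∘ reverse) (map-∘ p) ⟨
      filter (0 <?_) (reverse (map (f ∘ proj₁) p))
        ≡⟨ cong (filter (0 <?_) ∘ reverse) (map-cong-local (envelope-fits gap)) ⟩
      filter (0 <?_) (reverse (map proj₂ p))
        ≡⟨ cong (filter (0 <?_) ∘ reverse) (trans eq (sym rev)) ⟩
      filter (0 <?_) (reverse (reverse μ))
        ≡⟨ cong (filter (0 <?_)) (reverse-involutive μ) ⟩
      filter (0 <?_) μ
        ≡⟨ filter-all (0 <?_) pos ⟩
      μ ∎)
    where
    open ≡-Reasoning
    f = envelope p
    C = columns (width α) f
    g : ℕ → ℕ
    g a = ∣ row (width α) a ∩ C ∣
    f0≡0 : f 0 ≡ 0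
    -- The chain starts with threshold m, so `bound` reads m + k ≤ x + m and no ramp is positive at
    -- 0.
    f0≡0 = envelope-zero (All.map (λ {(x , k)} le →
      +-cancelˡ-≤ m k x (≤-trans le (≤-reflexive (+-comm x m)))) bound)
    g≡f : ∀ {a} → a ≤ width α → g a ≡ f a
    g≡f {a} a≤ = trans (sym (+-identityʳ (g a))) (trans (cong (g a +_) (sym f0≡0))
      (columns-count f (envelope-mono p) (envelope-suc p) a≤))

  -- Counting the avoiding partitions.

  InAv⇔Missing : ∀ {μ m ν} → IsPartition μ → reverse μ ≡ m ∷ ν →
           ∀ n α → InAv μ n α ⇔ Missing 1 m (gaps m ν) n (reverse α)
  InAv⇔Missing {μ} (isPartition dμ pμ) rev n α = mk⇔
    (λ { (isPartition d p , s , av) →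
      All-resp-↭ (↭-sym (↭-reverse α)) p ,
      AllPairs-reverse (Linked⇒AllPairs (flip ≤-trans) d) ,
      trans (sum-↭ (↭-reverse α)) s ,
      av ∘ Chain⇒Contains {α} pμ (Linked⇒AllPairs (flip ≤-trans) dμ) rev })
    (λ (p , asc , s , ¬ch) →
      let desc = subst (AllPairs _≥_) (reverse-involutive α) (AllPairs-reverse asc) in
      isPartition (AllPairs⇒Linked desc) (All-resp-↭ (↭-reverse α) p) ,
      trans (sym (sum-↭ (↭-reverse α))) s ,
      ¬ch ∘ Contains⇒Chain {α} desc rev)

  -- Positive parts mean b = 0. The threshold is the least part e + 1 of μ, which leaves the sizes
  -- 1, ..., e free.
  Av-count : ∀ {μ e ν} → IsPartition μ → reverse μ ≡ suc e ∷ ν →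
             ∀ n → ℤ.+ length (Av μ n) ≡ W e (sol (gaps (suc e) ν)) 0 n
  Av-count {μ} {e} {ν} isP rev n = trans (cong ℤ.+_ (sym (length-map reverse (Av μ n))))
    (Count-unique (counted 0 n (gaps (suc e) ν) e)
      (Unique.map⁺ reverse-injective (Av-unique μ n))
      λ l → mk⇔
        (λ l∈ → let α , α∈ , eq = ∈-map⁻ reverse l∈ in
          subst (Missing 1 _ _ n) (sym eq) (to (InAv⇔Missing isP rev n α) (to (∈-Av μ n α) α∈)))
        (λ x → subst (_∈ map reverse (Av μ n)) (reverse-involutive l)
          (∈-map⁺ reverse (from (∈-Av μ n (reverse l)) (from (InAv⇔Missing isP rev n (reverse l))
            (subst (Missing 1 _ _ n) (sym (reverse-involutive l)) x))))))

  gaps-≥2 : ∀ {m ν} → AllPairs (λ a b → a ≤ b × 2 ≤ ∣ b - a ∣) (m ∷ ν) → All (2 ≤_) (gaps m ν)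
  gaps-≥2 {ν = []}    _ = []
  gaps-≥2 {m} {k ∷ ν} (((m≤k , far) ∷ _) ∷ rest) =
    subst (2 ≤_) (trans (∣-∣-comm k m) (m≤n⇒∣m-n∣≡n∸m m≤k)) far ∷ gaps-≥2 rest

  Contains-[] : ∀ α → α Contains []
  Contains-[] α with R , eq ← ⊆-select (minimum α) =
    R , tabulate (λ _ → false) , cong (filter (0 <?_) ∘ map _) eq

  Av-[] : ∀ n → Av [] n ≡ []
  Av-[] n with Av [] n in eq
  ... | []    = refl
  ... | α ∷ _ = ⊥-elim (proj₂ (proj₂ (to (∈-Av [] n α) (subst (α ∈_) (sym eq) (here refl)))) (Contains-[] α))

  avoidanceSeries-fractional : ∀ μ → IsPartition μ → SuperStrict μ → Fractional (avoidanceSeries μ)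
  avoidanceSeries-fractional μ isP@(isPartition d pos) strict with reverse μ in rev
  -- Every partition contains the empty one, so for empty μ the series is 0.
  ... | [] with refl ← trans (sym (reverse-involutive μ)) (cong reverse rev) = finite (0 , λ {n} _ → zeros n)
    where
    zeros : ∀ n → avoidanceSeries [] n ≡ 0ℤ
    zeros zero    = refl
    zeros (suc n) = cong (ℤ.+_ ∘ length) (Av-[] (suc n))
  ... | zero ∷ ν with () ∷ _ ← subst (All (0 <_)) rev (All-resp-↭ (↭-sym (↭-reverse μ)) pos)
  ... | suc e ∷ ν = Fractional-cong series
    -- `W e F 0` also counts the empty partition; subtracting `one` removes it, as the series starts
    -- at n = 1.
    (Fractional-⊕ (Fractional-W e (Tame⇒Fractional (sol-tame far)) 0) (finite (Finite-⊖ Finite-one)))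
    where
    far : All (2 ≤_) (gaps (suc e) ν)
    far = gaps-≥2 (subst (AllPairs _) rev (AllPairs-reverse
      (AllPairs.zip (Linked⇒AllPairs (flip ≤-trans) d , strict))))
    F = sol (gaps (suc e) ν)
    series : W e F 0 ⊕ (⊖ one) ≗ avoidanceSeries μ
    series zero    = cong (λ z → z ℤ.- one 0) (W-small e F (sol-small (gaps (suc e) ν)) 0 z≤n)
    series (suc n) = trans (ℤ.+-identityʳ _) (sym (Av-count isP rev (suc n)))

open Series
open Containment

mainTheorem8 : (μ : List ℕ) → IsPartition μ → SuperStrict μ → IsRational (avoidanceSeries μ)
mainTheorem8 μ isP strict = Fractional⇒IsRational (avoidanceSeries-fractional μ isP strict)
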